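{- For every nonnegative integer $n$, $$\overline{p}_o(n)=\sum_{j=0}^{\infty}pod\!\left(n-\frac{j(j+1)}{2}\right).$$
   Context: $pod(n)$ denotes the number of partitions of $n$ in which odd parts are distinct and even parts may be repeated, with $pod(0)=1$ and $pod(m)=0$ for $m<0$. An overpartition of $n$ is a non-increasing sequence of positive integers with sum $n$ in which the first occurrence of each number may be overlined; $\overline{p}_o(n)$ is the number of overpartitions of $n$ into odd parts, with $\overline{p}_o(0)=1$. -}

module Defs where

open import Data.Bool using (Bool; true; false; T; T?)
open import Data.Integer using (ℤ; +_; -[1+_])
open import Data.List using (List; []; _∷_; length; map; filter; applyUpTo; cartesianProduct; cartesianProductWith)
open import Data.List.Membership.Propositional using (_∈_)
open import Data.List.Membership.Propositional.Properties using (∈-cartesianProductWith⁺; ∈-cartesianProduct⁺; ∈-applyUpTo⁺; ∈-filter⁺; ∈-filter⁻)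
open import Data.List.Properties using (∷-injective; length-map)
open import Data.List.Relation.Unary.All using (All; []; _∷_; all?)
import Data.List.Relation.Unary.All.Properties as All
open import Data.List.Relation.Unary.AllPairs using (AllPairs; []; _∷_; allPairs?)
open import Data.List.Relation.Unary.Any using (here; there)
open import Data.List.Relation.Unary.Unique.Propositional using (Unique)
import Data.List.Relation.Unary.Unique.Propositional.Properties as Unique
open import Data.Nat using (ℕ; zero; suc; _+_; _*_; _/_; _≤_; _<_; _≥_; z≤n; s≤s; _≟_; _≥?_; _<?_)
open import Data.Nat.Divisibility using (_∣_; _∣?_)
open import Data.Nat.ListAction using (sum)
open import Data.Nat.Properties using (≤-trans; ≤-reflexive; +-mono-≤; m≤m+n; m≤n+m; suc-injective; <⇒≢)
open import Data.Product using (∃-syntax; _×_; _,_; proj₁; proj₂)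
open import Function using (_∘_; _⇔_; mk⇔)
open import Relation.Binary.PropositionalEquality using (_≡_; _≢_; refl; subst)
open import Relation.Nullary using (¬_; ¬?; Dec; _×-dec_; _→-dec_)

Odd : ℕ → Set
Odd k = ¬ (2 ∣ k)

odd? : ∀ k → Dec (Odd k)
odd? k = ¬? (2 ∣? k)

IsPartition : ℕ → List ℕ → Set
IsPartition n xs = AllPairs _≥_ xs × All (0 <_) xs × sum xs ≡ n

isPartition? : ∀ n xs → Dec (IsPartition n xs)
isPartition? n xs = allPairs? _≥?_ xs ×-dec all? (0 <?_) xs ×-dec (sum xs ≟ n)

IsPodPartition : ℕ → List ℕ → Set
IsPodPartition n xs = IsPartition n xs × AllPairs (λ a b → Odd a → a ≢ b) xs

isPodPartition? : ∀ n xs → Dec (IsPodPartition n xs)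
isPodPartition? n xs =
  isPartition? n xs ×-dec allPairs? (λ a b → odd? a →-dec ¬? (a ≟ b)) xs

-- A part together with a mark; true means overlined.
Part : Set
Part = ℕ × Bool

size : Part → ℕ
size = proj₁

Overlined : Part → Set
Overlined = T ∘ proj₂

-- AllPairs R relates each entry to every later one, so the second
-- component says that an overlined entry is the first of its size.
IsOverpartition : ℕ → List Part → Set
IsOverpartition n ps =
  IsPartition n (map size ps) ×
  AllPairs (λ p q → Overlined q → size p ≢ size q) ps

IsOddOverpartition : ℕ → List Part → Set
IsOddOverpartition n ps = IsOverpartition n ps × All (Odd ∘ size) ps

isOddOverpartition? : ∀ n ps → Dec (IsOddOverpartition n ps)
isOddOverpartition? n ps =
  (isPartition? n (map size ps) ×-dec
   allPairs? (λ p q → T? (proj₂ q) →-dec ¬? (size p ≟ size q)) ps) ×-dec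
  all? (odd? ∘ size) ps

listsUpTo : ∀ {A : Set} → ℕ → List A → List (List A)
listsUpTo zero    as = [] ∷ []
listsUpTo (suc k) as = [] ∷ cartesianProductWith _∷_ as (listsUpTo k as)

-- A partition of n has at most n parts, each between 1 and n.  That the
-- two lists below contain exactly the intended objects, each once, is
-- shown by ∈-podPartitions, podPartitions-unique and their analogues.

podPartitions : ℕ → List (List ℕ)
podPartitions n = filter (isPodPartition? n) (listsUpTo n (applyUpTo suc n))

parts : ℕ → List Part
parts n = cartesianProduct (applyUpTo suc n) (false ∷ true ∷ [])

oddOverpartitions : ℕ → List (List Part)
oddOverpartitions n = filter (isOddOverpartition? n) (listsUpTo n (parts n))

pod : ℤ → ℕ
pod (+ n)    = length (podPartitions n)
pod -[1+ _ ] = 0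

p̄ₒ : ℕ → ℕ
p̄ₒ n = length (oddOverpartitions n)

-- The division is exact.
triangular : ℕ → ℕ
triangular j = (j * (j + 1)) / 2

-- f 0 + f 1 + f 2 + ⋯ converges to s; in ℕ this means that the partial
-- sums are eventually equal to s.
infix 4 _SumsTo_

_SumsTo_ : (ℕ → ℕ) → ℕ → Set
f SumsTo s = ∃[ N ] (∀ M → N ≤ M → sum (applyUpTo f M) ≡ s)

∈-listsUpTo : ∀ {A : Set} {as : List A} k {xs} →
              length xs ≤ k → All (_∈ as) xs → xs ∈ listsUpTo k as
∈-listsUpTo zero    {[]}     _         _          = here refl
∈-listsUpTo (suc k) {[]}     _         _          = here refl
∈-listsUpTo (suc k) {x ∷ xs} (s≤s len) (x∈ ∷ xs∈) =
  there (∈-cartesianProductWith⁺ _∷_ x∈ (∈-listsUpTo k len xs∈))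

listsUpTo-unique : ∀ {A : Set} {as : List A} k →
                   Unique as → Unique (listsUpTo k as)
listsUpTo-unique zero    _ = [] ∷ []
listsUpTo-unique {A} {as} (suc k) u =
  []∉ as ∷ Unique.cartesianProductWith⁺ _∷_ ∷-injective u (listsUpTo-unique k u)
  where
  []∉ : ∀ bs → All ([] ≢_) (cartesianProductWith _∷_ bs (listsUpTo k as))
  []∉ []       = []
  []∉ (b ∷ bs) = All.++⁺ (All.map⁺ (universal (listsUpTo k as))) ([]∉ bs)
    where
    universal : ∀ yss → All (λ ys → [] ≢ b ∷ ys) yss
    universal []         = []
    universal (_ ∷ yss) = (λ ()) ∷ universal yss

length≤sum : ∀ {xs} → All (0 <_) xs → length xs ≤ sum xs
length≤sum []         = z≤n
length≤sum (0<x ∷ ps) = +-mono-≤ 0<x (length≤sum ps)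

bounded : ∀ {xs} m → All (0 <_) xs → sum xs ≤ m → All (_∈ applyUpTo suc m) xs
bounded             m []              _  = []
bounded {suc x ∷ xs} m (s≤s z≤n ∷ ps) le =
  ∈-applyUpTo⁺ suc (≤-trans (m≤m+n (suc x) (sum xs)) le) ∷
  bounded m ps (≤-trans (m≤n+m (sum xs) (suc x)) le)

applyUpTo-suc-unique : ∀ n → Unique (applyUpTo suc n)
applyUpTo-suc-unique n =
  Unique.applyUpTo⁺₁ suc n (λ i<j _ eq → <⇒≢ i<j (suc-injective eq))

∈-podPartitions : ∀ {n xs} → xs ∈ podPartitions n ⇔ IsPodPartition n xs
∈-podPartitions {n} {xs} = mk⇔
  (proj₂ ∘ ∈-filter⁻ (isPodPartition? n) {xs = listsUpTo n (applyUpTo suc n)})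
  (λ { pr@((_ , pos , Σ≡n) , _) → ∈-filter⁺ (isPodPartition? n)
         (∈-listsUpTo n (≤-trans (length≤sum pos) (≤-reflexive Σ≡n))
                        (bounded n pos (≤-reflexive Σ≡n)))
         pr })

podPartitions-unique : ∀ n → Unique (podPartitions n)
podPartitions-unique n =
  Unique.filter⁺ (isPodPartition? n) (listsUpTo-unique n (applyUpTo-suc-unique n))

∈-oddOverpartitions : ∀ {n ps} → ps ∈ oddOverpartitions n ⇔ IsOddOverpartition n ps
∈-oddOverpartitions {n} {ps} = mk⇔
  (proj₂ ∘ ∈-filter⁻ (isOddOverpartition? n) {xs = listsUpTo n (parts n)})
  (λ { pr@(((_ , pos , Σ≡n) , _) , _) → ∈-filter⁺ (isOddOverpartition? n)
         (∈-listsUpTo n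
           (subst (_≤ n) (length-map size ps)
                  (≤-trans (length≤sum pos) (≤-reflexive Σ≡n)))
           (mark ps (bounded n pos (≤-reflexive Σ≡n))))
         pr })
  where
  bool : ∀ b → b ∈ (false ∷ true ∷ [])
  bool false = here refl
  bool true  = there (here refl)

  mark : ∀ qs → All (_∈ applyUpTo suc n) (map size qs) → All (_∈ parts n) qs
  mark []             []        = []
  mark ((_ , b) ∷ qs) (x∈ ∷ r) = ∈-cartesianProduct⁺ x∈ (bool b) ∷ mark qs r

oddOverpartitions-unique : ∀ n → Unique (oddOverpartitions n)
oddOverpartitions-unique n =
  Unique.filter⁺ (isOddOverpartition? n)
    (listsUpTo-unique n
      (Unique.cartesianProduct⁺ (applyUpTo-suc-unique n)
        (((λ ()) ∷ []) ∷ [] ∷ [])))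

{-# OPTIONS --safe #-}
module Submission where

-- Dividing both generating functions by ∏ (1 + q²ⁱ⁺¹), the theorem becomes Gauss'
-- identity ∏ 1 / (1 - q²ⁱ⁺¹) = ψ ∏ 1 / (1 - q²ⁱ⁺²), where ψ = Σ qʲ⁽ʲ⁺¹⁾ᐟ².  It is the
-- limit of a finite identity of Shanks, cleared here of all subtractions:
-- with Eₛ = ∏_{i < s} 1 / (1 - q²ⁱ⁺²) and Oₛ,ₙ = ∏_{s ≤ i < n} 1 / (1 - q²ⁱ⁺¹),
--   Σ_{s ≤ n} Eₛ Oₛ,ₙ q^(s (2n + 1)) = Eₙ Σ_{j ≤ 2n} q^(j (j + 1) / 2),
-- proved by telescoping the difference of consecutive left-hand sides.
-- Modulo q²ⁿ⁺¹ only the term s = 0 survives on the left.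
--
-- Both kinds of partitions are non-increasing lists over a chain of possible
-- entries, some of which may be repeated; overpartitions into odd parts use
-- 1 < 1̄ < 3 < 3̄ < ⋯, where exactly the parts without a mark may be repeated.

open import Algebra using (CommutativeSemiring; IsCommutativeMonoid)
import Algebra.Construct.Pointwise as Pointwise
import Algebra.Properties.Semiring.Exp as Exp
import Algebra.Solver.Ring.NaturalCoefficients.Default as SemiringSolver
open import Algebra.Structures.Biased using (isCommutativeSemiringˡ)
open import Data.Bool using (Bool; true; false; T; not; if_then_else_)
open import Data.Empty using (⊥; ⊥-elim)
import Data.Integer.Properties as ℤ
open import Data.List using (List; []; _∷_; _++_; length; map; applyUpTo)
open import Data.List.Membership.Propositional using (_∈_)
open import Data.List.Membership.Propositional.Properties
  using (∈-++⁺ˡ; ∈-++⁺ʳ; ∈-++⁻; ∈-map⁺; ∈-map⁻)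
open import Data.List.Membership.Propositional.Properties.WithK using (unique∧set⇒bag)
open import Data.List.Properties
  using (length-++; length-map; map-injective; map-∘; applyUpTo-∷ʳ; ∷-injective)
open import Data.List.Relation.Binary.BagAndSetEquality using (∼bag⇒↭)
open import Data.List.Relation.Binary.Permutation.Propositional.Properties using (↭-length)
open import Data.List.Relation.Unary.All as All using (All; []; _∷_)
import Data.List.Relation.Unary.All.Properties as All
open import Data.List.Relation.Unary.AllPairs as AllPairs using (AllPairs; []; _∷_)
import Data.List.Relation.Unary.AllPairs.Properties as AllPairs
open import Data.List.Relation.Unary.Any using (here)
open import Data.List.Relation.Unary.Unique.Propositional using (Unique)
import Data.List.Relation.Unary.Unique.Propositional.Properties as Unique
open import Data.Nat
  using (ℕ; zero; suc; _+_; _*_; _∸_; _/_; _≤_; _<_; _≥_; z≤n; s≤s; _<?_)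
  renaming (_^_ to _ℕ^_)
open import Data.Nat.DivMod using (_%_; /-monoˡ-≤; m*n/n≡m; m<n⇒m%n≡m; [m+n]%n≡m%n)
open import Data.Nat.Divisibility using (_∣0; ∣-refl; ∣m∣n⇒∣m+n; ∣m+n∣m⇒∣n; ∣⇒≤)
open import Data.Nat.Induction using (<-rec)
open import Data.Nat.ListAction using (sum)
open import Data.Nat.ListAction.Properties using (sum-++)
import Data.Nat.Properties as ℕ
open import Data.Nat.Tactic.RingSolver using (solve-∀)
open import Data.Product using (∃-syntax; _×_; _,_; proj₁; proj₂)
open import Data.Sum as Sum using (_⊎_; inj₁; inj₂; [_,_]′)
open import Defs
open import Function using (_∘_; _⇔_; mk⇔; Equivalence)
import Function.Properties.Equivalence as ⇔
open import Level using (0ℓ)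
open import Relation.Binary.PropositionalEquality as ≡
  using (_≡_; _≢_; _≗_; cong; cong₂; subst)
open import Relation.Nullary using (¬_; yes; no)

-- Triangular numbers of odd and even index.

triangular-unique : ∀ j {m} → j * (j + 1) ≡ m * 2 → triangular j ≡ m
triangular-unique j {m} eq = ≡.trans (cong (_/ 2) eq) (m*n/n≡m m 2)

triangular-odd : ∀ n → triangular (1 + 2 * n) ≡ suc n * (1 + 2 * n)
triangular-odd n = triangular-unique (1 + 2 * n) (identity n)
  where
  identity : ∀ n → (1 + 2 * n) * ((1 + 2 * n) + 1) ≡ (suc n * (1 + 2 * n)) * 2
  identity = solve-∀

triangular-even : ∀ n → triangular (2 + 2 * n) ≡ suc n * (3 + 2 * n)
triangular-even n = triangular-unique (2 + 2 * n) (identity n)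
  where
  identity : ∀ n → (2 + 2 * n) * ((2 + 2 * n) + 1) ≡ (suc n * (3 + 2 * n)) * 2
  identity = solve-∀

-- Shanks' identity in a commutative semiring

module Sums {c ℓ} (R : CommutativeSemiring c ℓ) where
  open CommutativeSemiring R renaming (_+_ to _⊕_; _*_ to _⊛_)
  open import Relation.Binary.Reasoning.Setoid setoid
  open SemiringSolver R
  open Exp semiring using (_^_; ^-homo-*; ^-congʳ)

  ∑< : ℕ → (ℕ → Carrier) → Carrier
  ∑< zero    f = 0#
  ∑< (suc n) f = ∑< n f ⊕ f n

  ∏< : ℕ → (ℕ → Carrier) → Carrier
  ∏< zero    f = 1#
  ∏< (suc n) f = f n ⊛ ∏< n f

  -- In both applications the items of a chain alternate between two types; this separates the
  -- factors of the two types.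
  ∏<-interleave : ∀ n {f g h} → (∀ i → f (i * 2) ≈ g i) → (∀ i → f (suc (i * 2)) ≈ h i) →
                  ∏< (n * 2) f ≈ ∏< n g ⊛ ∏< n h
  ∏<-interleave zero    even odd = sym (*-identityˡ 1#)
  ∏<-interleave (suc n) even odd =
    trans (*-cong (odd n) (*-cong (even n) (∏<-interleave n even odd)))
          (solve 4 (λ a b c d → b :* (a :* (c :* d)) := (a :* c) :* (b :* d)) refl _ _ _ _)

  -- Summands receive both s and d = n - s, which keeps truncated subtraction out of Shanks'
  -- identity.
  antidiagonal : (ℕ → ℕ → Carrier) → ℕ → Carrier
  antidiagonal f zero    = f 0 0
  antidiagonal f (suc n) = f 0 (suc n) ⊕ antidiagonal (λ i → f (suc i)) n

  antidiagonal-cong : ∀ n {f g} → (∀ i j → i + j ≡ n → f i j ≈ g i j) →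
                      antidiagonal f n ≈ antidiagonal g n
  antidiagonal-cong zero    eq = eq 0 0 ≡.refl
  antidiagonal-cong (suc n) eq = +-cong (eq 0 (suc n) ≡.refl)
    (antidiagonal-cong n (λ i j i+j≡n → eq (suc i) j (cong suc i+j≡n)))

  antidiagonal-* : ∀ x f n →
                   antidiagonal (λ i j → x ⊛ f i j) n ≈ x ⊛ antidiagonal f n
  antidiagonal-* x f zero    = refl
  antidiagonal-* x f (suc n) =
    trans (+-congˡ (antidiagonal-* x (λ i → f (suc i)) n)) (sym (distribˡ x _ _))

  antidiagonal-last : ∀ f n → antidiagonal f (suc n) ≈
                      antidiagonal (λ i j → f i (suc j)) n ⊕ f (suc n) 0
  antidiagonal-last f zero    = refl
  antidiagonal-last f (suc n) =
    trans (+-congˡ (antidiagonal-last (λ i → f (suc i)) n)) (sym (+-assoc _ _ _))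

  -- A semiring has no cancellation, so `G (suc i) j` is handed on to the next pair, whose left side
  -- needs exactly this value. Only the two outermost values of `G` survive.
  antidiagonal-telescope : ∀ n {f g h G : ℕ → ℕ → Carrier} →
    (∀ i j → i + j ≡ n → f i j ⊕ G i (suc j) ≈ g i j ⊕ (G (suc i) j ⊕ h i j)) →
    antidiagonal f n ⊕ G 0 (suc n) ≈
    antidiagonal g n ⊕ (G (suc n) 0 ⊕ antidiagonal h n)
  antidiagonal-telescope zero    step = step 0 0 ≡.refl
  antidiagonal-telescope (suc n) {f} {g} {h} {G} step = begin
    (f 0 (suc n) ⊕ f′) ⊕ G 0 (2 + n)
      ≈⟨ solve 3 (λ a b c → (a :+ b) :+ c := (a :+ c) :+ b) refl _ _ _ ⟩
    (f 0 (suc n) ⊕ G 0 (2 + n)) ⊕ f′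
      ≈⟨ +-congʳ (step 0 (suc n) ≡.refl) ⟩
    (g 0 (suc n) ⊕ (G 1 (suc n) ⊕ h 0 (suc n))) ⊕ f′
      ≈⟨ solve 4 (λ a b c d → (a :+ (b :+ c)) :+ d := (a :+ c) :+ (d :+ b)) refl _ _ _ _ ⟩
    (g 0 (suc n) ⊕ h 0 (suc n)) ⊕ (f′ ⊕ G 1 (suc n))
      ≈⟨ +-congˡ (antidiagonal-telescope n {G = λ i → G (suc i)}
           (λ i j i+j≡n → step (suc i) j (cong suc i+j≡n))) ⟩
    (g 0 (suc n) ⊕ h 0 (suc n)) ⊕ (g′ ⊕ (G (2 + n) 0 ⊕ h′))
      ≈⟨ solve 5 (λ a b c d e → (a :+ b) :+ (c :+ (d :+ e)) := (a :+ c) :+ (d :+ (b :+ e)))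
               refl _ _ _ _ _ ⟩
    (g 0 (suc n) ⊕ g′) ⊕ (G (2 + n) 0 ⊕ (h 0 (suc n) ⊕ h′)) ∎
    where
    f′ = antidiagonal (λ i → f (suc i)) n
    g′ = antidiagonal (λ i → g (suc i)) n
    h′ = antidiagonal (λ i → h (suc i)) n

  geometric-* : ∀ {x g} y → g ≈ 1# ⊕ x ⊛ g → g ⊛ y ≈ y ⊕ x ⊛ (g ⊛ y)
  geometric-* {x} {g} y g≈ = begin
    g ⊛ y              ≈⟨ *-congʳ g≈ ⟩
    (1# ⊕ x ⊛ g) ⊛ y   ≈⟨ solve 3 (λ x g y → (con 1 :+ x :* g) :* y :=
                                             y :+ x :* (g :* y)) refl _ _ _ ⟩
    y ⊕ x ⊛ (g ⊛ y)    ∎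

  -- geo k plays the role of 1 / (1 - q ^ suc k).
  module Shanks (q : Carrier) (geo : ℕ → Carrier)
    (geo-unfold : ∀ k → geo k ≈ 1# ⊕ q ^ suc k ⊛ geo k)
    (geo-unique : ∀ k x y → x ≈ y ⊕ q ^ suc k ⊛ x → x ≈ geo k ⊛ y)
    where

    geo-* : ∀ k y → geo k ⊛ y ≈ y ⊕ q ^ suc k ⊛ (geo k ⊛ y)
    geo-* k y = geometric-* y (geo-unfold k)

    evenGeo oddGeo : ℕ → Carrier
    evenGeo i = geo (1 + 2 * i)
    oddGeo  i = geo (2 * i)

    evens : ℕ → Carrier
    evens n = ∏< n evenGeo

    -- This is Oₛ,ₙ with n = s + d. The recursion exposes the first factor and `odds-last` the last
    -- one; the telescoping unfolds both.
    odds : ℕ → ℕ → Carrier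
    odds s zero    = 1#
    odds s (suc d) = oddGeo s ⊛ odds (suc s) d

    odds-last : ∀ s d → odds s (suc d) ≈ oddGeo (s + d) ⊛ odds s d
    odds-last s zero    = *-congʳ (reflexive (cong oddGeo (≡.sym (ℕ.+-identityʳ s))))
    odds-last s (suc d) = begin
      oddGeo s ⊛ odds (suc s) (suc d)
        ≈⟨ *-congˡ (odds-last (suc s) d) ⟩
      oddGeo s ⊛ (oddGeo (suc s + d) ⊛ odds (suc s) d)
        ≈⟨ solve 3 (λ a b c → a :* (b :* c) := b :* (a :* c)) refl _ _ _ ⟩
      oddGeo (suc s + d) ⊛ (oddGeo s ⊛ odds (suc s) d)
        ≈⟨ *-congʳ (reflexive (cong oddGeo (≡.sym (ℕ.+-suc s d)))) ⟩
      oddGeo (s + suc d) ⊛ odds s (suc d) ∎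

    odds≈∏ : ∀ n → odds 0 n ≈ ∏< n oddGeo
    odds≈∏ zero    = refl
    odds≈∏ (suc n) = trans (odds-last 0 n) (*-congˡ (odds≈∏ n))

    term : ℕ → ℕ → Carrier
    term s d = evens s ⊛ odds s d ⊛ q ^ (s * (1 + 2 * (s + d)))

    -- The telescoping quantity. For s + d = n + 1 and s > 0 it is Eₛ₋₁ Oₛ,ₙ₊₁ q^(s (2n + 1)), the
    -- part of Eₛ Oₛ,ₙ₊₁ q^(s (2n + 1)) that comes from the 1 in the unfolding of the last even
    -- factor. E₀ has no factor to unfold, hence the value 0.
    gap : ℕ → ℕ → Carrier
    gap zero    d = 0#
    gap (suc s) d = evens s ⊛ odds (suc s) d ⊛ q ^ (suc s * (1 + 2 * (s + d)))

    module _ (s d : ℕ) where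
      private
        n = s + d
        p = q ^ (s * (1 + 2 * n))
        a = q ^ (2 * s)
        b = q ^ (1 + 2 * n)
        X = evens s ⊛ odds s (suc d) ⊛ p

      term-suc : term s (suc d) ≈ a ⊛ X
      term-suc = begin
        evens s ⊛ odds s (suc d) ⊛ q ^ (s * (1 + 2 * (s + suc d)))
          ≈⟨ *-congˡ (trans (^-congʳ q (identity s d))
                        (^-homo-* q (2 * s) (s * (1 + 2 * n)))) ⟩
        evens s ⊛ odds s (suc d) ⊛ (a ⊛ p)
          ≈⟨ solve 3 (λ x a p → x :* (a :* p) := a :* (x :* p)) refl _ _ _ ⟩
        a ⊛ X ∎
        where
        identity : ∀ s d → s * (1 + 2 * (s + suc d)) ≡ 2 * s + s * (1 + 2 * (s + d))
        identity = solve-∀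

      last-factor : X ≈ term s d ⊕ b ⊛ X
      last-factor = begin
        evens s ⊛ odds s (suc d) ⊛ p
          ≈⟨ *-congʳ (*-congˡ (trans (odds-last s d) (geo-* (2 * n) (odds s d)))) ⟩
        evens s ⊛ (odds s d ⊕ b ⊛ (oddGeo n ⊛ odds s d)) ⊛ p
          ≈⟨ *-congʳ (*-congˡ (+-congˡ (*-congˡ (odds-last s d)))) ⟨
        evens s ⊛ (odds s d ⊕ b ⊛ odds s (suc d)) ⊛ p
          ≈⟨ solve 5 (λ e o b o′ p → e :* (o :+ b :* o′) :* p :=
                                     e :* o :* p :+ b :* (e :* o′ :* p))
                     refl _ _ _ _ _ ⟩
        term s d ⊕ b ⊛ X ∎

      -- Unfolding 1 / (1 - q^(2s + 1)) yields q a, which combines with b to q^(2n + 2) a. The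
      -- exponent 2n + 2 does not depend on s, so this power can later be taken out of the whole
      -- sum.
      first-odd-factor : b ⊛ X ≈ gap (suc s) d ⊕ q ^ (2 + 2 * n) ⊛ (a ⊛ X)
      first-odd-factor = begin
        b ⊛ (evens s ⊛ odds s (suc d) ⊛ p)
          ≈⟨ *-congˡ (*-congʳ (*-congˡ (geo-* (2 * s) (odds (suc s) d)))) ⟩
        b ⊛ (evens s ⊛ (odds (suc s) d ⊕ q ⊛ a ⊛ odds s (suc d)) ⊛ p)
          ≈⟨ solve 7 (λ b e o q a o′ p → b :* (e :* (o :+ q :* a :* o′) :* p) :=
                       e :* o :* (b :* p) :+ q :* b :* (a :* (e :* o′ :* p)))
                     refl _ _ _ _ _ _ _ ⟩
        evens s ⊛ odds (suc s) d ⊛ (b ⊛ p) ⊕ q ^ (2 + 2 * n) ⊛ (a ⊛ X)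
          ≈⟨ +-congʳ (*-congˡ (^-homo-* q (1 + 2 * n) (s * (1 + 2 * n)))) ⟨
        gap (suc s) d ⊕ q ^ (2 + 2 * n) ⊛ (a ⊛ X) ∎

    -- For s > 0, unfolding 1 / (1 - q^(2s)) leaves `gap` and a remainder with the extra power
    -- q^(2s), which raises the exponent s (2n + 1) to s (2n + 3).
    last-even-factor : ∀ s d →
      evens s ⊛ odds s (suc d) ⊛ q ^ (s * (1 + 2 * (s + d))) ≈
      term s (suc d) ⊕ gap s (suc d)
    last-even-factor zero    d =
      trans (sym (trans (term-suc 0 d) (*-identityˡ _))) (sym (+-identityʳ _))
    last-even-factor (suc s) d = begin
      evenGeo s ⊛ evens s ⊛ o ⊛ p
        ≈⟨ *-congʳ (*-congʳ (geo-* (1 + 2 * s) (evens s))) ⟩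
      (evens s ⊕ a ⊛ evens (suc s)) ⊛ o ⊛ p
        ≈⟨ solve 5 (λ e a e′ o p → (e :+ a :* e′) :* o :* p :=
                      a :* (e′ :* o :* p) :+ e :* o :* p) refl _ _ _ _ _ ⟩
      a ⊛ (evens (suc s) ⊛ o ⊛ p) ⊕ evens s ⊛ o ⊛ p
        ≈⟨ +-cong (*-congʳ (^-congʳ q (≡.sym (ℕ.*-suc 2 s))))
                  (*-congˡ (^-congʳ q (cong (λ m → suc s * (1 + 2 * m))
                                              (≡.sym (ℕ.+-suc s d))))) ⟩
      q ^ (2 * suc s) ⊛ (evens (suc s) ⊛ o ⊛ p) ⊕ gap (suc s) (suc d)
        ≈⟨ +-congʳ (term-suc (suc s) d) ⟨
      term (suc s) (suc d) ⊕ gap (suc s) (suc d) ∎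
      where
      o = odds (suc s) (suc d)
      p = q ^ (suc s * (1 + 2 * (suc s + d)))
      a = q ^ (2 + 2 * s)

    -- Both sides equal Eₛ Oₛ,ₙ₊₁ q^(s (2n + 1)) with n = s + d, from which the last even,
    -- the last odd and the first odd factor are unfolded in turn.
    term-telescope : ∀ s d →
      term s (suc d) ⊕ gap s (suc d) ≈
      term s d ⊕ (gap (suc s) d ⊕ q ^ (2 + 2 * (s + d)) ⊛ term s (suc d))
    term-telescope s d = begin
      term s (suc d) ⊕ gap s (suc d)  ≈⟨ last-even-factor s d ⟨
      _                               ≈⟨ last-factor s d ⟩
      _                               ≈⟨ +-congˡ (first-odd-factor s d) ⟩
      _                               ≈⟨ +-congˡ (+-congˡ (*-congˡ (term-suc s d))) ⟨
      term s d ⊕ (gap (suc s) d ⊕ q ^ (2 + 2 * (s + d)) ⊛ term s (suc d)) ∎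

    ψ : ℕ → Carrier
    ψ n = ∑< n (λ j → q ^ triangular j)

    term-last : ∀ s → term s 0 ≈ evens s ⊛ q ^ (s * (1 + 2 * s))
    term-last s = *-cong (*-identityʳ _)
      (^-congʳ q (cong (λ m → s * (1 + 2 * m)) (ℕ.+-identityʳ s)))

    gap-last : ∀ n → gap (suc n) 0 ≈ evens n ⊛ q ^ triangular (1 + 2 * n)
    gap-last n = *-cong (*-identityʳ _) (^-congʳ q (≡.trans
      (cong (λ m → suc n * (1 + 2 * m)) (ℕ.+-identityʳ n)) (≡.sym (triangular-odd n))))

    -- Induction on n. Going to n + 1, the last `gap` and the new corner term supply the two further
    -- summands of `ψ`, each times Eₙ. The new sum S then satisfies S = Eₙ ψ + q^(2n + 2) S, and
    -- solving for S multiplies by the next even factor.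
    shanks : ∀ n → antidiagonal term n ≈ evens n ⊛ ψ (1 + 2 * n)
    shanks zero    = solve 0 (con 1 :* con 1 :* con 1 := con 1 :* (con 0 :+ con 1)) refl
    shanks (suc n) = begin
      antidiagonal term (suc n)
        ≈⟨ geo-unique (1 + 2 * n) (antidiagonal term (suc n)) (evens n ⊛ ψ (3 + 2 * n))
                      recurrence ⟩
      evenGeo n ⊛ (evens n ⊛ ψ (3 + 2 * n))
        ≈⟨ *-assoc _ _ _ ⟨
      evens (suc n) ⊛ ψ (3 + 2 * n)
        ≈⟨ *-congˡ (reflexive (cong (λ m → ψ (suc m)) (≡.sym (ℕ.*-suc 2 n)))) ⟩
      evens (suc n) ⊛ ψ (1 + 2 * suc n) ∎
      where
      x = q ^ (2 + 2 * n)
      u = q ^ triangular (1 + 2 * n)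
      v = q ^ triangular (2 + 2 * n)
      Σ′ = antidiagonal (λ i j → term i (suc j)) n

      corner : term (suc n) 0 ≈ evens n ⊛ v ⊕ x ⊛ term (suc n) 0
      corner = begin
        term (suc n) 0
          ≈⟨ term-last (suc n) ⟩
        evenGeo n ⊛ evens n ⊛ w
          ≈⟨ *-congʳ (geo-* (1 + 2 * n) (evens n)) ⟩
        (evens n ⊕ x ⊛ evens (suc n)) ⊛ w
          ≈⟨ solve 4 (λ e x e′ w → (e :+ x :* e′) :* w := e :* w :+ x :* (e′ :* w))
                     refl _ _ _ _ ⟩
        evens n ⊛ w ⊕ x ⊛ (evens (suc n) ⊛ w)
          ≈⟨ +-cong (*-congˡ (^-congʳ q (≡.trans (cong (λ m → suc n * suc m) (ℕ.*-suc 2 n))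
                                                 (≡.sym (triangular-even n)))))
                    (*-congˡ (sym (term-last (suc n)))) ⟩
        evens n ⊛ v ⊕ x ⊛ term (suc n) 0 ∎
        where w = q ^ (suc n * (1 + 2 * suc n))

      recurrence : antidiagonal term (suc n) ≈
                   evens n ⊛ ψ (3 + 2 * n) ⊕ x ⊛ antidiagonal term (suc n)
      recurrence = begin
        antidiagonal term (suc n)
          ≈⟨ antidiagonal-last term n ⟩
        Σ′ ⊕ term (suc n) 0
          -- The added 0 is `gap 0 (suc n)`, the left end of the telescope.
          ≈⟨ +-cong (trans (sym (+-identityʳ Σ′)) (antidiagonal-telescope n {G = gap}
               (λ { s d ≡.refl → term-telescope s d }))) corner ⟩
        (antidiagonal term n ⊕ (gap (suc n) 0 ⊕ antidiagonal (λ i j → x ⊛ term i (suc j)) n))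
          ⊕ (evens n ⊛ v ⊕ x ⊛ term (suc n) 0)
          ≈⟨ +-congʳ (+-cong (shanks n) (+-cong (gap-last n) (antidiagonal-* x _ n))) ⟩
        (evens n ⊛ ψ (1 + 2 * n) ⊕ (evens n ⊛ u ⊕ x ⊛ Σ′)) ⊕ (evens n ⊛ v ⊕ x ⊛ term (suc n) 0)
          ≈⟨ solve 7 (λ e p u x s v t →
               (e :* p :+ (e :* u :+ x :* s)) :+ (e :* v :+ x :* t) :=
               e :* ((p :+ u) :+ v) :+ x :* (s :+ t)) refl _ _ _ _ _ _ _ ⟩
        evens n ⊛ ψ (3 + 2 * n) ⊕ x ⊛ (Σ′ ⊕ term (suc n) 0)
          ≈⟨ +-congˡ (*-congˡ (antidiagonal-last term n)) ⟨
        evens n ⊛ ψ (3 + 2 * n) ⊕ x ⊛ antidiagonal term (suc n) ∎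

    -- Only the term with s = 0 contributes below q ^ (1 + 2 * n).
    shanks-mod : ∀ n → ∃[ r ] evens n ⊛ ψ (1 + 2 * n) ≈ odds 0 n ⊕ q ^ (1 + 2 * n) ⊛ r
    shanks-mod zero    = 0# ,
      solve 1 (λ x → con 1 :* (con 0 :+ con 1) := con 1 :+ x :* con 0) refl _
    shanks-mod (suc n) = _ , (begin
      evens (suc n) ⊛ ψ (1 + 2 * suc n)
        ≈⟨ shanks (suc n) ⟨
      term 0 (suc n) ⊕ antidiagonal (λ s → term (suc s)) n
        ≈⟨ +-cong (solve 1 (λ o → con 1 :* o :* con 1 := o) refl _)
                  (trans (antidiagonal-cong n factor) (antidiagonal-* y _ n)) ⟩
      odds 0 (suc n) ⊕ y ⊛ antidiagonal rest n ∎)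
      where
      y = q ^ (1 + 2 * suc n)
      rest : ℕ → ℕ → Carrier
      rest s d = evens (suc s) ⊛ odds (suc s) d ⊛ q ^ (s * (1 + 2 * suc n))

      factor : ∀ s d → s + d ≡ n → term (suc s) d ≈ y ⊛ rest s d
      factor s d ≡.refl = begin
        term (suc s) d
          ≈⟨ *-congˡ (^-homo-* q (1 + 2 * suc n) (s * (1 + 2 * suc n))) ⟩
        evens (suc s) ⊛ odds (suc s) d ⊛ (y ⊛ q ^ (s * (1 + 2 * suc n)))
          ≈⟨ solve 3 (λ e y z → e :* (y :* z) := y :* (e :* z)) refl _ _ _ ⟩
        y ⊛ rest s d ∎

    -- Here `x` will be the product of the 1 + q²ⁱ⁺¹, common to both generating functions.
    shanks-mod-* : ∀ x n → ∃[ r ]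
      x ⊛ evens n ⊛ ψ (1 + 2 * n) ≈ x ⊛ odds 0 n ⊕ q ^ (1 + 2 * n) ⊛ r
    shanks-mod-* x n = let r , eq = shanks-mod n in x ⊛ r , (begin
      x ⊛ evens n ⊛ ψ (1 + 2 * n)
        ≈⟨ *-assoc x (evens n) (ψ (1 + 2 * n)) ⟩
      x ⊛ (evens n ⊛ ψ (1 + 2 * n))
        ≈⟨ *-congˡ eq ⟩
      x ⊛ (odds 0 n ⊕ q ^ (1 + 2 * n) ⊛ r)
        ≈⟨ solve 4 (λ x o y r → x :* (o :+ y :* r) := x :* o :+ y :* (x :* r))
                   refl _ _ _ _ ⟩
      x ⊛ odds 0 n ⊕ q ^ (1 + 2 * n) ⊛ (x ⊛ r) ∎)

-- Power series over ℕ

open ≡ using (refl; trans; sym)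

Series : Set
Series = ℕ → ℕ

infixl 6 _⊕_
infixl 7 _⊛_

_⊕_ : Series → Series → Series
(f ⊕ g) n = f n + g n

-- The Cauchy product, using f = f(0) + q g with g the shift of f; this avoids indices n - i.
_⊛_ : Series → Series → Series
(f ⊛ g) zero    = f 0 * g 0
(f ⊛ g) (suc n) = f 0 * g (suc n) + (f ∘ suc ⊛ g) n

zeroₛ oneₛ q : Series
zeroₛ _ = 0
oneₛ n = 0 ℕ^ n -- 0 ℕ^ 0 is 1
q zero    = 0
q (suc n) = oneₛ n

⊛-cong : ∀ {f f′ g g′} → f ≗ f′ → g ≗ g′ → f ⊛ g ≗ f′ ⊛ g′
⊛-cong f≗ g≗ zero    = cong₂ _*_ (f≗ 0) (g≗ 0)
⊛-cong f≗ g≗ (suc n) = cong₂ _+_ (cong₂ _*_ (f≗ 0) (g≗ (suc n))) (⊛-cong (f≗ ∘ suc) g≗ n)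

⊛-zeroˡ : ∀ f → zeroₛ ⊛ f ≗ zeroₛ
⊛-zeroˡ f zero    = refl
⊛-zeroˡ f (suc n) = ⊛-zeroˡ f n

⊛-identityˡ : ∀ f → oneₛ ⊛ f ≗ f
⊛-identityˡ f zero    = ℕ.*-identityˡ (f 0)
⊛-identityˡ f (suc n) =
  trans (cong₂ _+_ (ℕ.*-identityˡ (f (suc n))) (⊛-zeroˡ f n)) (ℕ.+-identityʳ _)

⊛-distribʳ-⊕ : ∀ h f g → (f ⊕ g) ⊛ h ≗ (f ⊛ h) ⊕ (g ⊛ h)
⊛-distribʳ-⊕ h f g zero    = ℕ.*-distribʳ-+ (h 0) (f 0) (g 0)
⊛-distribʳ-⊕ h f g (suc n) =
  trans (cong ((f 0 + g 0) * h (suc n) +_) (⊛-distribʳ-⊕ h (f ∘ suc) (g ∘ suc) n))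
        (lemma (f 0) (g 0) (h (suc n)) _ _)
  where
  lemma : ∀ a b c x y → (a + b) * c + (x + y) ≡ a * c + x + (b * c + y)
  lemma = solve-∀

⊛-scaleˡ : ∀ a f g → (λ n → a * f n) ⊛ g ≗ λ n → a * (f ⊛ g) n
⊛-scaleˡ a f g zero    = ℕ.*-assoc a (f 0) (g 0)
⊛-scaleˡ a f g (suc n) =
  trans (cong (a * f 0 * g (suc n) +_) (⊛-scaleˡ a (f ∘ suc) g n))
        (lemma a (f 0) (g (suc n)) _)
  where
  lemma : ∀ a b c x → a * b * c + a * x ≡ a * (b * c + x)
  lemma = solve-∀

⊛-assoc : ∀ f g h → (f ⊛ g) ⊛ h ≗ f ⊛ (g ⊛ h)
⊛-assoc f g h zero    = ℕ.*-assoc (f 0) (g 0) (h 0)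
⊛-assoc f g h (suc n) = begin
  f 0 * g 0 * h (suc n) + (((λ m → f 0 * g (suc m)) ⊕ (f ∘ suc ⊛ g)) ⊛ h) n
    ≡⟨ cong (f 0 * g 0 * h (suc n) +_) (⊛-distribʳ-⊕ h _ (f ∘ suc ⊛ g) n) ⟩
  f 0 * g 0 * h (suc n) + (((λ m → f 0 * g (suc m)) ⊛ h) n + ((f ∘ suc ⊛ g) ⊛ h) n)
    ≡⟨ cong (f 0 * g 0 * h (suc n) +_)
         (cong₂ _+_ (⊛-scaleˡ (f 0) (g ∘ suc) h n) (⊛-assoc (f ∘ suc) g h n)) ⟩
  f 0 * g 0 * h (suc n) + (f 0 * (g ∘ suc ⊛ h) n + (f ∘ suc ⊛ (g ⊛ h)) n)
    ≡⟨ lemma (f 0) (g 0) (h (suc n)) _ _ ⟩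
  f 0 * (g 0 * h (suc n) + (g ∘ suc ⊛ h) n) + (f ∘ suc ⊛ (g ⊛ h)) n ∎
  where
  open ≡.≡-Reasoning
  lemma : ∀ a b c x y → a * b * c + (a * x + y) ≡ a * (b * c + x) + y
  lemma = solve-∀

-- The mirror image of the defining recursion, which makes commutativity an induction on the degree.
⊛-sucʳ : ∀ f g n → (f ⊛ g) (suc n) ≡ f (suc n) * g 0 + (f ⊛ g ∘ suc) n
⊛-sucʳ f g zero    = ℕ.+-comm (f 0 * g 1) (f 1 * g 0)
⊛-sucʳ f g (suc n) =
  trans (cong (f 0 * g (2 + n) +_) (⊛-sucʳ (f ∘ suc) g n))
        (lemma (f 0 * g (2 + n)) (f (2 + n) * g 0) _)
  where
  lemma : ∀ a x y → a + (x + y) ≡ x + (a + y)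
  lemma = solve-∀

⊛-comm : ∀ f g → f ⊛ g ≗ g ⊛ f
⊛-comm f g zero    = ℕ.*-comm (f 0) (g 0)
⊛-comm f g (suc n) =
  trans (⊛-sucʳ f g n) (cong₂ _+_ (ℕ.*-comm (f (suc n)) (g 0)) (⊛-comm f (g ∘ suc) n))

ℕ[[q]] : CommutativeSemiring 0ℓ 0ℓ
ℕ[[q]] = record
  { isCommutativeSemiring = isCommutativeSemiringˡ (record
    { +-isCommutativeMonoid = ⊕-isCommutativeMonoid
    ; *-isCommutativeMonoid = record
      { isMonoid = record
        { isSemigroup = record
          { isMagma = record
            { isEquivalence = IsCommutativeMonoid.isEquivalence ⊕-isCommutativeMonoid
            ; ∙-cong = ⊛-cong
            }
          ; assoc = ⊛-assoc
          }
        ; identity = ⊛-identityˡ , λ f n → trans (⊛-comm f oneₛ n) (⊛-identityˡ f n)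
        }
      ; comm = ⊛-comm
      }
    ; distribʳ = ⊛-distribʳ-⊕
    ; zeroˡ = ⊛-zeroˡ
    })
  }
  where
  ⊕-isCommutativeMonoid : IsCommutativeMonoid _≗_ _⊕_ zeroₛ
  ⊕-isCommutativeMonoid = Pointwise.isCommutativeMonoid ℕ ℕ.+-0-isCommutativeMonoid

open CommutativeSemiring ℕ[[q]] using (semiring; *-congˡ; *-congʳ; distribˡ; zeroʳ)
open Exp semiring using (_^_)
open Sums ℕ[[q]]

q-⊛ : ∀ f n → (q ⊛ f) (suc n) ≡ f n
q-⊛ f n = ⊛-identityˡ f n

q^-⊛-< : ∀ k f {n} → n < k → (q ^ k ⊛ f) n ≡ 0
q^-⊛-< (suc k) f {n} n<k = trans (⊛-assoc q (q ^ k) f n) (lemma n n<k)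
  where
  lemma : ∀ n → n < suc k → (q ⊛ (q ^ k ⊛ f)) n ≡ 0
  lemma zero    _         = refl
  lemma (suc n) (s≤s n<k) = trans (q-⊛ (q ^ k ⊛ f) n) (q^-⊛-< k f n<k)

q^-⊛-+ : ∀ k f n → (q ^ k ⊛ f) (k + n) ≡ f n
q^-⊛-+ zero    f n = ⊛-identityˡ f n
q^-⊛-+ (suc k) f n =
  trans (⊛-assoc q (q ^ k) f (suc k + n))
        (trans (q-⊛ (q ^ k ⊛ f) (k + n)) (q^-⊛-+ k f n))

-- The two cases for a coefficient of `q ^ k ⊛ f`: it vanishes, or its index has the form `k + n`
-- and it is a coefficient of `f`.
data Split (k : ℕ) : ℕ → Set where
  below : ∀ {n} → n < k → Split k n
  above : ∀ n → Split k (k + n)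

split : ∀ k n → Split k n
split k n with n <? k
... | yes n<k = below n<k
... | no  n≮k = ≡.subst (Split k) (ℕ.m+[n∸m]≡n (ℕ.≮⇒≥ n≮k)) (above (n ∸ k))

-- The series 1 / (1 - q^(k + 1)): `0 ℕ^ r` is 1 for r = 0 and 0 otherwise, so it marks the
-- multiples of k + 1.
geo : ℕ → Series
geo k n = 0 ℕ^ (n % suc k)

geo-unfold : ∀ k → geo k ≗ oneₛ ⊕ q ^ suc k ⊛ geo k
geo-unfold k n with split (suc k) n
... | below n<k = trans (cong (0 ℕ^_) (m<n⇒m%n≡m n<k))
  (sym (trans (cong (0 ℕ^ n +_) (q^-⊛-< (suc k) (geo k) n<k)) (ℕ.+-identityʳ _)))
... | above m = trans
  (cong (0 ℕ^_) (trans (cong (_% suc k) (ℕ.+-comm (suc k) m)) ([m+n]%n≡m%n m (suc k))))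
  (sym (q^-⊛-+ (suc k) (geo k) m))

-- The factor `q ^ suc k` has positive degree, so each coefficient is determined by `h` and strictly
-- earlier coefficients.
fixed-point-unique : ∀ k f g h → f ≗ h ⊕ q ^ suc k ⊛ f → g ≗ h ⊕ q ^ suc k ⊛ g → f ≗ g
fixed-point-unique k f g h f≗ g≗ = <-rec _ go
  where
  go : ∀ n → (∀ {m} → m < n → f m ≡ g m) → f n ≡ g n
  go n rec = trans (f≗ n) (trans (cong (h n +_) (tails n rec)) (sym (g≗ n)))
    where
    tails : ∀ n → (∀ {m} → m < n → f m ≡ g m) →
            (q ^ suc k ⊛ f) n ≡ (q ^ suc k ⊛ g) n
    tails n rec with split (suc k) n
    ... | below n<k = trans (q^-⊛-< (suc k) f n<k) (sym (q^-⊛-< (suc k) g n<k))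
    ... | above m   = trans (q^-⊛-+ (suc k) f m)
      (trans (rec (s≤s (ℕ.m≤n+m m k))) (sym (q^-⊛-+ (suc k) g m)))

geo-⊛ : ∀ k f → geo k ⊛ f ≗ f ⊕ q ^ suc k ⊛ (geo k ⊛ f)
geo-⊛ k f = geometric-* f (geo-unfold k)

geo-unique : ∀ k f g → f ≗ g ⊕ q ^ suc k ⊛ f → f ≗ geo k ⊛ g
geo-unique k f g f≗ = fixed-point-unique k f (geo k ⊛ g) g f≗ (geo-⊛ k g)

-- Counting non-increasing lists

open Equivalence using (to; from)

private
  variable
    A B : Set
    P Q : A → Set
    c d : ℕ

HasCount : (A → Set) → ℕ → Set
HasCount P c = ∃[ xs ] Unique xs × (∀ {x} → x ∈ xs ⇔ P x) × length xs ≡ c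

-- Duplicate-free lists with the same members are permutations of each other.
count-unique : HasCount P c → HasCount P d → c ≡ d
count-unique (xs , xs! , ∈xs , refl) (ys , ys! , ∈ys , refl) =
  ↭-length (∼bag⇒↭ (unique∧set⇒bag xs! ys! (⇔.trans ∈xs (⇔.sym ∈ys))))

count-⇔ : (∀ {x} → P x ⇔ Q x) → HasCount P c → HasCount Q c
count-⇔ P⇔Q (xs , xs! , ∈xs , len) = xs , xs! , ⇔.trans ∈xs P⇔Q , len

count-⊎ : (∀ {x} → P x → Q x → ⊥) → HasCount P c → HasCount Q d →
          HasCount (λ x → P x ⊎ Q x) (c + d)
count-⊎ disjoint (xs , xs! , ∈xs , refl) (ys , ys! , ∈ys , refl) =
  xs ++ ys ,
  Unique.++⁺ xs! ys! (λ (x∈xs , x∈ys) → disjoint (to ∈xs x∈xs) (to ∈ys x∈ys)) ,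
  mk⇔ ([ inj₁ ∘ to ∈xs , inj₂ ∘ to ∈ys ]′ ∘ ∈-++⁻ xs)
      [ ∈-++⁺ˡ ∘ from ∈xs , ∈-++⁺ʳ xs ∘ from ∈ys ]′ ,
  length-++ xs

count-map : (f : A → B) → (∀ {x y} → f x ≡ f y → x ≡ y) → HasCount P c →
            HasCount (λ y → ∃[ x ] P x × y ≡ f x) c
count-map f f-injective (xs , xs! , ∈xs , refl) =
  map f xs ,
  Unique.map⁺ f-injective xs! ,
  mk⇔ (λ y∈ → let x , x∈ , y≡ = ∈-map⁻ f y∈ in x , to ∈xs x∈ , y≡)
      (λ { (x , Px , refl) → ∈-map⁺ f (from ∈xs Px) }) ,
  length-map f xs

module Chains (repeatable : ℕ → Bool) (w : ℕ → ℕ) where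

  infix 4 _Follows_
  _Follows_ : ℕ → ℕ → Set
  j Follows i = j < i ⊎ (j ≡ i × T (repeatable i))

  -- The item i has size suc (w i).
  Chain : ℕ → ℕ → List ℕ → Set
  Chain t n is =
    AllPairs (λ i j → j Follows i) is × All (_< t) is × sum (map (suc ∘ w) is) ≡ n

  -- Expresses `_Follows_` as a strict upper bound, so that the tail of a chain is again a chain.
  bound : ℕ → ℕ
  bound i = if repeatable i then suc i else i

  bound≤ : ∀ i → bound i ≤ suc i
  bound≤ i with repeatable i
  ... | true  = ℕ.≤-refl
  ... | false = ℕ.n≤1+n i

  follows⇔ : ∀ {i j} → j Follows i ⇔ j < bound i
  follows⇔ {i} with repeatable i
  ... | true  = mk⇔ [ ℕ.m<n⇒m<1+n , (λ { (refl , _) → ℕ.n<1+n i }) ]′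
                    (λ { (s≤s j≤i) → [ inj₁ , (λ eq → inj₂ (eq , _)) ]′ (ℕ.m≤n⇒m<n∨m≡n j≤i) })
  ... | false = mk⇔ [ (λ j<i → j<i) , (λ ()) ]′ inj₁

  -- Generating function for the multiplicity of one item: arbitrary, or at most 1.
  factor : ℕ → Series
  factor i = if repeatable i then geo (w i) else oneₛ ⊕ q ^ suc (w i)

  chainSeries : ℕ → Series
  chainSeries t = ∏< t factor

  -- The algebraic form of a dichotomy: a chain below t + 1 avoids t, or it is t followed by a chain
  -- below `bound t`.
  chainSeries-suc : ∀ t →
    chainSeries (suc t) ≗ chainSeries t ⊕ q ^ suc (w t) ⊛ chainSeries (bound t)
  chainSeries-suc t with repeatable t in eq
  ... | true  = λ n → trans (geo-⊛ (w t) (chainSeries t) n)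
    (cong (chainSeries t n +_) (⊛-cong {f = q ^ suc (w t)} (λ _ → refl)
      (λ m → cong (λ b → ((if b then geo (w t) else _) ⊛ chainSeries t) m) (sym eq)) n))
  ... | false = λ n → trans (⊛-distribʳ-⊕ (chainSeries t) oneₛ _ n)
    (cong (_+ (q ^ suc (w t) ⊛ chainSeries t) n) (⊛-identityˡ (chainSeries t) n))

  chain-∷ : ∀ {t m is} → Chain (suc t) (suc (w t) + m) (t ∷ is) ⇔ Chain (bound t) m is
  chain-∷ {t} = mk⇔
    (λ { (t> ∷ desc , _ , Σ≡) → desc , All.map (to follows⇔) t> ,
      ℕ.+-cancelˡ-≡ (suc (w t)) _ _ Σ≡ })
    (λ { (desc , is< , Σ≡) →
      All.map (from follows⇔) is< ∷ desc ,
      ℕ.n<1+n t ∷ All.map (λ i< → ℕ.<-≤-trans i< (bound≤ t)) is< ,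
      cong (suc (w t) +_) Σ≡ })

  chain-weaken : ∀ {t n is} → Chain t n is → Chain (suc t) n is
  chain-weaken (desc , is< , Σ≡) = desc , All.map ℕ.m<n⇒m<1+n is< , Σ≡

  follows⇒≤ : ∀ {i j} → j Follows i → j ≤ i
  follows⇒≤ = [ ℕ.<⇒≤ , ℕ.≤-reflexive ∘ proj₁ ]′

  -- Chains are non-increasing, so the head alone decides whether t occurs.
  chain-suc : ∀ {t n is} → Chain (suc t) n is →
              Chain t n is ⊎ ∃[ js ] Chain (suc t) n (t ∷ js) × is ≡ t ∷ js
  chain-suc {is = []} (desc , _ , Σ≡) = inj₁ (desc , [] , Σ≡)
  chain-suc {is = i ∷ is} ch@(i> ∷ desc , s≤s i≤t ∷ _ , Σ≡) with ℕ.m≤n⇒m<n∨m≡n i≤t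
  ... | inj₁ i<t  = inj₁ (i> ∷ desc ,
    i<t ∷ All.map (λ j → ℕ.≤-<-trans (follows⇒≤ j) i<t) i> , Σ≡)
  ... | inj₂ refl = inj₂ (is , ch , refl)

  chain-∌ : ∀ {t n is} → Chain t n is → ∃[ js ] is ≡ t ∷ js → ⊥
  chain-∌ (_ , t<t ∷ _ , _) (_ , refl) = ℕ.<-irrefl refl t<t

  chain-head≤ : ∀ {s t n is} → Chain s n (t ∷ is) → suc (w t) ≤ n
  chain-head≤ (_ , _ , refl) = ℕ.m≤m+n _ _

  -- Induction on t, with strong induction on n inside, following `chainSeries-suc`. After a
  -- repeatable t the tail may still contain t, but its sum is smaller because sizes are positive.
  count-chains : ∀ t n → HasCount (Chain t n) (chainSeries t n)
  count-chains zero    zero    =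
    ([] ∷ []) , [] ∷ [] ,
    mk⇔ (λ { (here refl) → [] , [] , refl })
        (λ { ([] , [] , _) → here refl ; (_ ∷ _ , () ∷ _ , _) }) ,
    refl
  count-chains zero    (suc n) =
    [] , [] , mk⇔ (λ ()) (λ { ([] , [] , ()) ; (_ ∷ _ , () ∷ _ , _) }) , refl
  count-chains (suc t) = <-rec _ go
    where
    go : ∀ n → (∀ {m} → m < n → HasCount (Chain (suc t) m) (chainSeries (suc t) m)) →
         HasCount (Chain (suc t) n) (chainSeries (suc t) n)
    go n rec with split (suc (w t)) n
    ... | below n<w = subst (HasCount _)
      (sym (trans (chainSeries-suc t n)
        (trans (cong (chainSeries t n +_) (q^-⊛-< (suc (w t)) (chainSeries (bound t)) n<w))
               (ℕ.+-identityʳ _))))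
      (count-⇔ (mk⇔ chain-weaken (λ ch → [ (λ ch → ch) ,
         (λ { (_ , ch , _) → ⊥-elim (ℕ.<⇒≱ n<w (chain-head≤ ch)) }) ]′ (chain-suc ch)))
       (count-chains t n))
    ... | above m = subst (HasCount _)
      (sym (trans (chainSeries-suc t n) (cong (chainSeries t n +_)
        (q^-⊛-+ (suc (w t)) (chainSeries (bound t)) m))))
      (count-⇔ (mk⇔
          [ chain-weaken , (λ { (js , ch , refl) → from chain-∷ ch }) ]′
          (λ ch → [ inj₁ , (λ { (js , ch , eq) → inj₂ (js , to chain-∷ ch , eq) }) ]′
                  (chain-suc ch)))
        (count-⊎ (λ { ch (js , _ , eq) → chain-∌ ch (js , eq) })
          (count-chains t _)
          (count-map (t ∷_) (proj₂ ∘ ∷-injective) (smaller (repeatable t)))))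
      where
      smaller : ∀ b → let s = if b then suc t else t in HasCount (Chain s m) (chainSeries s m)
      smaller true  = rec (s≤s (ℕ.m≤n+m m (w t)))
      smaller false = count-chains t m

-- Partitions with distinct odd parts as chains.

isOdd : ℕ → Bool
isOdd zero          = false
isOdd (suc zero)    = true
isOdd (suc (suc n)) = isOdd n

odd-2+⇔ : ∀ n → Odd (2 + n) ⇔ Odd n
odd-2+⇔ n = mk⇔ (_∘ ∣m∣n⇒∣m+n ∣-refl) (_∘ λ 2∣ → ∣m+n∣m⇒∣n 2∣ ∣-refl)

¬odd-0 : ¬ Odd 0
¬odd-0 odd = odd (2 ∣0)

odd-1 : Odd 1
odd-1 2∣1 = ℕ.<⇒≱ (ℕ.n<1+n 1) (∣⇒≤ 2∣1)

even-suc⇔ : ∀ i → (¬ Odd (suc i)) ⇔ T (isOdd i)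
even-suc⇔ zero          = mk⇔ (λ even → even odd-1) (λ ())
even-suc⇔ (suc zero)    = mk⇔ _ (λ _ odd → odd ∣-refl)
even-suc⇔ (suc (suc i)) = mk⇔
  (λ even → to (even-suc⇔ i) (even ∘ from (odd-2+⇔ (suc i))))
  (λ t → from (even-suc⇔ i) t ∘ to (odd-2+⇔ (suc i)))

-- The item i is the part suc i.
module Pod = Chains isOdd (λ i → i)

-- Equal neighbours are allowed only for an even part i + 1, that is, for a repeatable item i.
pod-follows⇔ : ∀ {i j} →
  (suc i ≥ suc j × (Odd (suc i) → suc i ≢ suc j)) ⇔ (j Pod.Follows i)
pod-follows⇔ {i} = mk⇔ to′
  [ (λ j<i → ℕ.<⇒≤ (s≤s j<i) , λ _ eq → ℕ.<-irrefl (sym eq) (s≤s j<i))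
  , (λ { (refl , t) → ℕ.≤-refl , λ odd → ⊥-elim (from (even-suc⇔ i) t odd) }) ]′
  where
  to′ : ∀ {j} → suc i ≥ suc j × (Odd (suc i) → suc i ≢ suc j) → j Pod.Follows i
  to′ (s≤s j≤i , distinct) with ℕ.m≤n⇒m<n∨m≡n j≤i
  ... | inj₁ j<i  = inj₁ j<i
  ... | inj₂ refl = inj₂ (refl , to (even-suc⇔ i) (λ odd → distinct odd refl))

positive⇒map-suc : ∀ {xs} → All (0 <_) xs → ∃[ is ] xs ≡ map suc is
positive⇒map-suc []                = [] , refl
positive⇒map-suc (s≤s z≤n ∷ pos) =
  let is , eq = positive⇒map-suc pos in _ ∷ is , cong (_ ∷_) eq

map-suc-positive : ∀ (w : ℕ → ℕ) is → All (0 <_) (map (suc ∘ w) is)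
map-suc-positive w []       = []
map-suc-positive w (i ∷ is) = s≤s z≤n ∷ map-suc-positive w is

all≤sum : ∀ xs → All (_≤ sum xs) xs
all≤sum []       = []
all≤sum (x ∷ xs) = ℕ.m≤m+n x (sum xs) ∷
  All.map (λ y≤ → ℕ.≤-trans y≤ (ℕ.m≤n+m _ x)) (all≤sum xs)

-- Parts of a partition of n are at most n, so restricting the items to those below t loses nothing.
pod⇔chain : ∀ {t n} → n < t → ∀ {xs} →
            (∃[ is ] Pod.Chain t n is × xs ≡ map suc is) ⇔ IsPodPartition n xs
pod⇔chain {t} {n} n<t = mk⇔ to′ from′
  where
  to′ : ∀ {xs} → ∃[ is ] Pod.Chain t n is × xs ≡ map suc is → IsPodPartition n xs
  to′ (is , (desc , _ , Σ≡) , refl) =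
    let ge , distinct = AllPairs.unzipWith (from pod-follows⇔) desc in
    (AllPairs.map⁺ ge , map-suc-positive (λ i → i) is , Σ≡) , AllPairs.map⁺ distinct

  from′ : ∀ {xs} → IsPodPartition n xs → ∃[ is ] Pod.Chain t n is × xs ≡ map suc is
  from′ ((ge , pos , refl) , distinct) with positive⇒map-suc pos
  ... | is , refl = is ,
    ( AllPairs.zipWith (to pod-follows⇔) (AllPairs.map⁻ ge , AllPairs.map⁻ distinct)
    , All.map (λ i<n → ℕ.<-trans i<n n<t) (All.map⁻ (all≤sum (map suc is)))
    , refl ) , refl

pod≡chainSeries : ∀ {t n} → n < t → length (podPartitions n) ≡ Pod.chainSeries t n
pod≡chainSeries {t} {n} n<t = count-unique
  (podPartitions n , podPartitions-unique n , ∈-podPartitions , refl)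
  (count-⇔ (pod⇔chain n<t)
    (count-map (map suc) (map-injective ℕ.suc-injective) (Pod.count-chains t n)))

-- Overpartitions into odd parts as chains.

evenFloor : ℕ → ℕ
evenFloor zero          = 0
evenFloor (suc zero)    = 0
evenFloor (suc (suc i)) = 2 + evenFloor i

-- Enumerates the marked odd parts in the order 1, 1̄, 3, 3̄, 5, 5̄, …
oddPart : ℕ → Part
oddPart i = suc (evenFloor i) , isOdd i

-- In a descending chain an overlined part comes before the unmarked parts of its size. Since it
-- cannot be repeated, it is the first of its size.
module Over = Chains (not ∘ isOdd) evenFloor

evenFloor-reconstruct : ∀ i → i ≡ evenFloor i + (if isOdd i then 1 else 0)
evenFloor-reconstruct zero          = refl
evenFloor-reconstruct (suc zero)    = refl
evenFloor-reconstruct (suc (suc i)) = cong (2 +_) (evenFloor-reconstruct i)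

oddPart-injective : ∀ {i j} → oddPart i ≡ oddPart j → i ≡ j
oddPart-injective {i} {j} eq =
  trans (evenFloor-reconstruct i)
    (trans (cong₂ (λ m b → m + (if b then 1 else 0))
                  (ℕ.suc-injective (cong proj₁ eq)) (cong proj₂ eq))
           (sym (evenFloor-reconstruct j)))

oddPart-odd : ∀ i → Odd (size (oddPart i))
oddPart-odd zero          = odd-1
oddPart-odd (suc zero)    = odd-1
oddPart-odd (suc (suc i)) = from (odd-2+⇔ _) (oddPart-odd i)

oddPart-surjective : ∀ s b → Odd s → ∃[ i ] (s , b) ≡ oddPart i
oddPart-surjective zero          b     odd = ⊥-elim (¬odd-0 odd)
oddPart-surjective (suc zero)    false odd = 0 , refl
oddPart-surjective (suc zero)    true  odd = 1 , refl
oddPart-surjective (suc (suc s)) b     odd =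
  let i , eq = oddPart-surjective s b (to (odd-2+⇔ s) odd) in
  2 + i , cong (λ p → 2 + proj₁ p , proj₂ p) eq

-- With `all≤sum`, this places all items of an overpartition of n below any t > n.
i≤size-oddPart : ∀ i → i ≤ size (oddPart i)
i≤size-oddPart zero          = z≤n
i≤size-oddPart (suc zero)    = ℕ.≤-refl
i≤size-oddPart (suc (suc i)) = s≤s (s≤s (i≤size-oddPart i))

-- Both sides are unchanged when i and j grow by 2, which leaves the cases where one of them is 0 or
-- 1. If both are, the sizes agree and exactly j = 0, the unmarked part, may follow.
over-follows⇔ : ∀ i j →
  (size (oddPart i) ≥ size (oddPart j) ×
   (Overlined (oddPart j) → size (oddPart i) ≢ size (oddPart j))) ⇔ (j Over.Follows i)
over-follows⇔ zero       zero       = mk⇔ (λ _ → inj₂ (refl , _)) (λ _ → ℕ.≤-refl , λ ())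
over-follows⇔ zero       (suc zero) =
  mk⇔ (λ (_ , distinct) → ⊥-elim (distinct _ refl)) [ (λ ()) , (λ ()) ]′
over-follows⇔ (suc zero) zero       = mk⇔ (λ _ → inj₁ (s≤s z≤n)) (λ _ → ℕ.≤-refl , λ ())
over-follows⇔ (suc zero) (suc zero) =
  mk⇔ (λ (_ , distinct) → ⊥-elim (distinct _ refl)) [ (λ { (s≤s ()) }) , (λ ()) ]′
over-follows⇔ zero (suc (suc j)) =
  mk⇔ (λ { (s≤s () , _) }) [ (λ ()) , (λ ()) ]′
over-follows⇔ (suc zero) (suc (suc j)) =
  mk⇔ (λ { (s≤s () , _) }) [ (λ { (s≤s ()) }) , (λ ()) ]′
over-follows⇔ (suc (suc i)) zero =
  mk⇔ (λ _ → inj₁ (s≤s z≤n)) (λ _ → s≤s z≤n , λ ())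
over-follows⇔ (suc (suc i)) (suc zero) =
  mk⇔ (λ _ → inj₁ (s≤s (s≤s z≤n))) (λ _ → s≤s z≤n , λ _ ())
over-follows⇔ (suc (suc i)) (suc (suc j)) = mk⇔
  (λ { (s≤s (s≤s ge) , distinct) →
    Sum.map (λ j<i → s≤s (s≤s j<i)) (λ (eq , t) → cong (2 +_) eq , t)
      (to (over-follows⇔ i j) (ge , λ o eq → distinct o (cong (2 +_) eq))) })
  (λ follows →
    let ge , distinct = from (over-follows⇔ i j)
          (Sum.map (λ { (s≤s (s≤s j<i)) → j<i })
                   (λ (eq , t) → ℕ.suc-injective (ℕ.suc-injective eq) , t) follows)
    in s≤s (s≤s ge) , λ o eq → distinct o (ℕ.suc-injective (ℕ.suc-injective eq)))

odd⇒map-oddPart : ∀ {ps} → All (Odd ∘ size) ps → ∃[ is ] ps ≡ map oddPart is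
odd⇒map-oddPart []                          = [] , refl
odd⇒map-oddPart {(s , b) ∷ _} (odd ∷ odds) =
  let i , eq = oddPart-surjective s b odd
      is , eqs = odd⇒map-oddPart odds
  in i ∷ is , cong₂ _∷_ eq eqs

over⇔chain : ∀ {t n} → n < t → ∀ {ps} →
             (∃[ is ] Over.Chain t n is × ps ≡ map oddPart is) ⇔ IsOddOverpartition n ps
over⇔chain {t} {n} n<t = mk⇔ to′ from′
  where
  sizes : ∀ is → map (suc ∘ evenFloor) is ≡ map size (map oddPart is)
  sizes = map-∘

  to′ : ∀ {ps} → ∃[ is ] Over.Chain t n is × ps ≡ map oddPart is → IsOddOverpartition n ps
  to′ (is , (desc , _ , Σ≡) , refl) =
    let ge , distinct = AllPairs.unzipWith (from (over-follows⇔ _ _)) desc in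
    ( ( AllPairs.map⁺ (AllPairs.map⁺ ge)
      , subst (All (0 <_)) (sizes is) (map-suc-positive evenFloor is)
      , trans (cong sum (sym (sizes is))) Σ≡ )
    , AllPairs.map⁺ distinct )
    , All.map⁺ (All.universal oddPart-odd is)

  from′ : ∀ {ps} → IsOddOverpartition n ps → ∃[ is ] Over.Chain t n is × ps ≡ map oddPart is
  from′ (((ge , _ , refl) , distinct) , odd) with odd⇒map-oddPart odd
  ... | is , refl = is ,
    ( AllPairs.zipWith (to (over-follows⇔ _ _))
        (AllPairs.map⁻ (AllPairs.map⁻ ge) , AllPairs.map⁻ distinct)
    , All.map (λ {i} size≤n → ℕ.≤-<-trans (i≤size-oddPart i) (ℕ.≤-<-trans size≤n n<t))
        (All.map⁻ (All.map⁻ (all≤sum (map size (map oddPart is)))))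
    , cong sum (sizes is) ) , refl

p̄ₒ≡chainSeries : ∀ {t n} → n < t → p̄ₒ n ≡ Over.chainSeries t n
p̄ₒ≡chainSeries {t} {n} n<t = count-unique
  (oddOverpartitions n , oddOverpartitions-unique n , ∈-oddOverpartitions , refl)
  (count-⇔ (over⇔chain n<t)
    (count-map (map oddPart) (map-injective oddPart-injective) (Over.count-chains t n)))

-- Product formulas and their comparison through Shanks' identity.

open Shanks q geo geo-unfold geo-unique

distinctOdds : ℕ → Series
distinctOdds n = ∏< n (λ i → oneₛ ⊕ q ^ suc (2 * i))

isOdd-2* : ∀ n → isOdd (n * 2) ≡ false
isOdd-2* zero    = refl
isOdd-2* (suc n) = isOdd-2* n

isOdd-1+2* : ∀ n → isOdd (suc (n * 2)) ≡ true
isOdd-1+2* zero    = refl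
isOdd-1+2* (suc n) = isOdd-1+2* n

evenFloor-2* : ∀ n → evenFloor (n * 2) ≡ 2 * n
evenFloor-2* zero    = refl
evenFloor-2* (suc n) = trans (cong (2 +_) (evenFloor-2* n)) (sym (ℕ.*-suc 2 n))

evenFloor-1+2* : ∀ n → evenFloor (suc (n * 2)) ≡ 2 * n
evenFloor-1+2* zero    = refl
evenFloor-1+2* (suc n) = trans (cong (2 +_) (evenFloor-1+2* n)) (sym (ℕ.*-suc 2 n))

-- Items 2i and 2i + 1 are the parts 2i + 1, used at most once, and 2i + 2, freely repeatable.
pod-product : ∀ n → Pod.chainSeries (n * 2) ≗ distinctOdds n ⊛ evens n
pod-product n = ∏<-interleave n even odd
  where
  even : ∀ i → Pod.factor (i * 2) ≗ oneₛ ⊕ q ^ suc (2 * i)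
  even i m rewrite isOdd-2* i | ℕ.*-comm i 2 = refl
  odd : ∀ i → Pod.factor (suc (i * 2)) ≗ evenGeo i
  odd i m rewrite isOdd-1+2* i | ℕ.*-comm i 2 = refl

-- Items 2i and 2i + 1 are both the part 2i + 1: unmarked and repeatable, or overlined and used at
-- most once.
over-product : ∀ n → Over.chainSeries (n * 2) ≗ distinctOdds n ⊛ odds 0 n
over-product n m = trans (∏<-interleave n even odd m)
  (trans (⊛-comm (∏< n oddGeo) (distinctOdds n) m)
         (*-congˡ {distinctOdds n} (λ k → sym (odds≈∏ n k)) m))
  where
  even : ∀ i → Over.factor (i * 2) ≗ oddGeo i
  even i m rewrite isOdd-2* i | evenFloor-2* i = refl
  odd : ∀ i → Over.factor (suc (i * 2)) ≗ oneₛ ⊕ q ^ suc (2 * i)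
  odd i m rewrite isOdd-1+2* i | evenFloor-1+2* i = refl

over-expansion : ∀ n → ∃[ r ]
  Pod.chainSeries (n * 2) ⊛ ψ (1 + 2 * n) ≗
  Over.chainSeries (n * 2) ⊕ q ^ (1 + 2 * n) ⊛ r
over-expansion n = let r , eq = shanks-mod-* (distinctOdds n) n in r , λ m →
  trans (*-congʳ {ψ (1 + 2 * n)} (pod-product n) m)
    (trans (eq m) (cong (_+ (q ^ (1 + 2 * n) ⊛ r) m) (sym (over-product n m))))

-- From coefficients to the convergent sum.

sum-applyUpTo-suc : ∀ f n → sum (applyUpTo f (suc n)) ≡ sum (applyUpTo f n) + f n
sum-applyUpTo-suc f n = trans (cong sum (sym (applyUpTo-∷ʳ f n)))
  (trans (sum-++ (applyUpTo f n) (f n ∷ []))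
         (cong (sum (applyUpTo f n) +_) (ℕ.+-identityʳ (f n))))

sum-applyUpTo-stable : ∀ f m n → (∀ j → m ≤ j → f j ≡ 0) → m ≤ n →
                       sum (applyUpTo f n) ≡ sum (applyUpTo f m)
sum-applyUpTo-stable f m n f≡0 m≤n with ℕ.m≤n⇒m<n∨m≡n m≤n
... | inj₂ refl = refl
sum-applyUpTo-stable f m (suc n) f≡0 _ | inj₁ (s≤s m≤n) =
  trans (sum-applyUpTo-suc f n)
    (trans (cong₂ _+_ (sum-applyUpTo-stable f m n f≡0 m≤n) (f≡0 n m≤n)) (ℕ.+-identityʳ _))

-- A crude bound that suffices: for j > n the argument n - j (j + 1) / 2 is negative. For a positive
-- index j + 1 it comes from 2 ≤ j + 2.
j≤triangular : ∀ j → j ≤ triangular j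
j≤triangular zero    = z≤n
j≤triangular (suc j) = subst (_≤ triangular (suc j)) (m*n/n≡m (suc j) 2)
  (/-monoˡ-≤ 2 (ℕ.*-monoʳ-≤ (suc j) (ℕ.+-monoˡ-≤ 1 (s≤s (z≤n {j})))))

open import Data.Integer using (+_; _-_)

pod-negative : ∀ {n k} → n < k → pod (+ n - + k) ≡ 0
-- The difference is the negative of `k ∸ n`; positivity of the latter brings it to the form
-- `-[1+ _ ]`, where `pod` is 0.
pod-negative {n} {k} n<k rewrite ℤ.m-n≡m⊖n n k | ℤ.⊖-< n<k with k ∸ n | ℕ.m<n⇒0<n∸m n<k
... | suc _ | _ = refl

pod-+ : ∀ k n → pod (+ (k + n) - + k) ≡ pod (+ n)
pod-+ k n = cong pod (trans (ℤ.m-n≡m⊖n (k + n) k)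
  (trans (ℤ.⊖-≥ (ℕ.m≤m+n k n)) (cong +_ (ℕ.m+n∸m≡n k n))))

⊛-ψ : ∀ f n m → (f ⊛ ψ m) n ≡ sum (applyUpTo (λ j → (q ^ triangular j ⊛ f) n) m)
⊛-ψ f n zero    = zeroʳ f n
⊛-ψ f n (suc m) =
  trans (distribˡ f (ψ m) (q ^ triangular m) n)
    (trans (cong₂ _+_ (⊛-ψ f n m) (⊛-comm f (q ^ triangular m) n))
           (sym (sum-applyUpTo-suc _ m)))

applyUpTo-cong : ∀ {f g : ℕ → ℕ} → f ≗ g → applyUpTo f ≗ applyUpTo g
applyUpTo-cong f≗g zero    = refl
applyUpTo-cong f≗g (suc n) = cong₂ _∷_ (f≗g 0) (applyUpTo-cong (f≗g ∘ suc) n)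

-- One truncation t serves all shifts k, since n - k ≤ n < t.
pod-coefficient : ∀ {t n} → n < t → ∀ k →
                  pod (+ n - + k) ≡ (q ^ k ⊛ Pod.chainSeries t) n
pod-coefficient {t} {n} n<t k with split k n
... | below n<k = trans (pod-negative n<k) (sym (q^-⊛-< k (Pod.chainSeries t) n<k))
... | above m   = trans (pod-+ k m)
  (trans (pod≡chainSeries (ℕ.≤-<-trans (ℕ.m≤n+m m k) n<t))
         (sym (q^-⊛-+ k (Pod.chainSeries t) m)))

theorem4p8 : ∀ (n : ℕ) → (λ (j : ℕ) → pod (+ n - + triangular j)) SumsTo p̄ₒ n
theorem4p8 n = N , λ M N≤M → begin
  sum (applyUpTo f M)
    ≡⟨ sum-applyUpTo-stable f N M (λ j N≤j →
         pod-negative (ℕ.<-≤-trans n<N (ℕ.≤-trans N≤j (j≤triangular j)))) N≤M ⟩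
  sum (applyUpTo f N)
    ≡⟨ cong sum (applyUpTo-cong (pod-coefficient n<t ∘ triangular) N) ⟩
  sum (applyUpTo (λ j → (q ^ triangular j ⊛ Pod.chainSeries t) n) N)
    ≡⟨ ⊛-ψ (Pod.chainSeries t) n N ⟨
  (Pod.chainSeries t ⊛ ψ N) n
    ≡⟨ proj₂ (over-expansion (suc n)) n ⟩
  Over.chainSeries t n + (q ^ N ⊛ proj₁ (over-expansion (suc n))) n
    ≡⟨ cong₂ _+_ (refl {x = Over.chainSeries t n})
         (q^-⊛-< N (proj₁ (over-expansion (suc n))) n<N) ⟩
  Over.chainSeries t n + 0
    ≡⟨ ℕ.+-identityʳ _ ⟩
  Over.chainSeries t n
    ≡⟨ p̄ₒ≡chainSeries n<t ⟨
  p̄ₒ n ∎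
  where
  open ≡.≡-Reasoning
  f : ℕ → ℕ
  f j = pod (+ n - + triangular j)
  -- Both come from `over-expansion (suc n)`: t is the number of items, and N is both the length of
  -- `ψ` and the degree from which the remainder starts. Both exceed n.
  t N : ℕ
  t = suc n * 2
  N = 1 + 2 * suc n
  n<t : n < t
  n<t = ℕ.m≤m*n (suc n) 2
  n<N : n < N
  n<N = ℕ.m≤n⇒m≤1+n (ℕ.m≤m+n (suc n) _)
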